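{- One has the following recursion formula for the functions $F_r(x,y)$: $$(i)\quad F_0(x,y)=\frac1{(1-y)^2},$$ $$(ii)\quad F_r(x,y)=\frac{F_{r-1}(x,x^r)\,x^r-F_{r-1}(x,y)\,y}{(x^r-y)(1-y)}\qquad (r\ge1).$$
   Context: For integers $r,k,j\ge 0$ let $$\alpha_r(k,j)=\sum_{\substack{c_1+\cdots+c_r=k\\ 0\le c_1\le\cdots\le c_r}}\ \sum_{d_0=-j}^{0}\ \sum_{d_1=d_0}^{c_1}\ \sum_{d_2=d_1}^{c_2}\cdots\sum_{d_r=d_{r-1}}^{c_r}1,$$ with all $c_i,d_i$ integers (for $r=0$ the outer sum is empty unless $k=0$, in which case only the sum over $d_0$ remains). The generating function is $F_r(x,y)=\sum_{k,j=0}^\infty\alpha_r(k,j)x^ky^j$. The identities are understood as identities of formal power series in $x,y$ (in (ii), after multiplying by the denominator). -}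

module Defs where

open import Data.Integer as ℤ using (ℤ; +_; 0ℤ; 1ℤ; ∣_∣)
open import Data.List using (List; []; _∷_; applyUpTo; cartesianProductWith; filter; map; upTo)
open import Data.Nat as ℕ using (ℕ; zero; suc; _∸_; _≤_)
open import Data.Nat.ListAction using (sum)
open import Data.Product using (_×_)
open import Data.Vec as Vec using (Vec; []; _∷_)
open import Data.Vec.Relation.Unary.Linked using (Linked; linked?)
open import Relation.Binary.PropositionalEquality using (_≡_)
open import Relation.Nullary.Decidable using (Dec; _×-dec_)

-- The integers d with a ≤ d ≤ b; there are max(b + 1 - a, 0) of them.
[_⋯_] : ℤ → ℤ → List ℤ
[ a ⋯ b ] = applyUpTo (λ i → a ℤ.+ + i) ∣ (ℤ.suc b ℤ.- a) ℤ.⊔ 0ℤ ∣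

boundedTuples : (r k : ℕ) → List (Vec ℕ r)
boundedTuples zero    k = [] ∷ []
boundedTuples (suc r) k = cartesianProductWith _∷_ (upTo (suc k)) (boundedTuples r k)

IsSummationIndex : ∀ {r} → ℕ → Vec ℕ r → Set
IsSummationIndex k c = Vec.sum c ≡ k × Linked _≤_ c

isSummationIndex? : ∀ {r} k (c : Vec ℕ r) → Dec (IsSummationIndex k c)
isSummationIndex? k c = (Vec.sum c ℕ.≟ k) ×-dec linked? ℕ._≤?_ c

-- All (c₁, …, c_r) with c₁ + ⋯ + c_r = k and 0 ≤ c₁ ≤ ⋯ ≤ c_r.  Nonnegative
-- entries summing to k are at most k, so searching the box [0, k]^r loses nothing.
summationIndices : (r k : ℕ) → List (Vec ℕ r)
summationIndices r k = filter (isSummationIndex? k) (boundedTuples r k)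

-- innerSum d₀ (c₁, …, c_r) = Σ_{d₁ = d₀}^{c₁} Σ_{d₂ = d₁}^{c₂} ⋯ Σ_{d_r = d_{r-1}}^{c_r} 1
innerSum : ∀ {r} → ℤ → Vec ℕ r → ℕ
innerSum d []       = 1
innerSum d (c ∷ cs) = sum (map (λ d′ → innerSum d′ cs) [ d ⋯ + c ])

α : (r k j : ℕ) → ℕ
α r k j = sum (map (λ c → sum (map (λ d₀ → innerSum d₀ c) [ ℤ.- (+ j) ⋯ 0ℤ ]))
                   (summationIndices r k))

-- f m n is the coefficient of x^m y^n.
Series : Set
Series = ℕ → ℕ → ℤ

infix  4 _≈_
infixl 6 _⊖_
infixl 7 _⊛_
infixr 8 _^_
infix  9 _[y≔_]

_≈_ : Series → Series → Set
f ≈ g = ∀ m n → f m n ≡ g m n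

∑≤ : ℕ → (ℕ → ℤ) → ℤ
∑≤ zero    f = f 0
∑≤ (suc n) f = ∑≤ n f ℤ.+ f (suc n)

𝟙 : Series
𝟙 0 0 = 1ℤ
𝟙 _ _ = 0ℤ

X : Series
X 1 0 = 1ℤ
X _ _ = 0ℤ

Y : Series
Y 0 1 = 1ℤ
Y _ _ = 0ℤ

_⊖_ : Series → Series → Series
(f ⊖ g) m n = f m n ℤ.- g m n

_⊛_ : Series → Series → Series
(f ⊛ g) m n = ∑≤ m λ i → ∑≤ n λ j → f i j ℤ.* g (m ∸ i) (n ∸ j)

_^_ : Series → ℕ → Series
f ^ zero  = 𝟙
f ^ suc n = f ⊛ f ^ n

-- The coefficient of y^j in f, a power series in x alone.
coeffY : Series → ℕ → Series
coeffY f j m zero    = f m j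
coeffY f j m (suc n) = 0ℤ

-- f(x, g) = Σ_j (coeffY f j) g^j.  This is meaningful only when g has zero
-- constant term; then g^j has no terms of total degree below j, so only j ≤ m + n
-- contribute to the coefficient of x^m y^n.
_[y≔_] : Series → Series → Series
(f [y≔ g ]) m n = ∑≤ (m ℕ.+ n) λ j → (coeffY f j ⊛ g ^ j) m n

F : ℕ → Series
F r k j = + α r k j

{-# OPTIONS --safe #-}

-- Let b be the part of F_{r+1} with d₀ = -j, so that (1 - y) F_{r+1} = b.  In an
-- index (c₁, …, c_{r+1}) of b either c₁ = 0, and d₁ plays the role of d₀ for the
-- remaining c's, or all c's and d's can be lowered by 1, which lowers k by r + 1
-- and raises j by 1.  Hence, with q = x^{r+1},
--   b(x, y) = F_r(x, y) + q (b(x, y) - b(x, 0)) / y,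
-- that is, (q - y) b(x, y) = q b(x, 0) - y F_r(x, y).  Iterating the recursion at
-- y = 0 gives b(x, 0) = F_r(x, q).
module Submission where

open import Defs
open import Algebra.Properties.CommutativeSemigroup using (interchange)
open import Data.Empty using (⊥; ⊥-elim)
open import Data.Integer as ℤ using (ℤ; +_; -[1+_]; 0ℤ; 1ℤ)
import Data.Integer.Properties as ℤ
import Data.Integer.Tactic.RingSolver as ℤ
open import Data.List using (List; []; _∷_; _++_; applyUpTo; map)
open import Data.List.Membership.Propositional using (_∈_)
open import Data.List.Membership.Propositional.Properties
  using (∈-map⁺; ∈-map⁻; ∈-++⁺ˡ; ∈-++⁺ʳ; ∈-++⁻; ∈-filter⁺; ∈-filter⁻;
         ∈-upTo⁺; ∈-cartesianProductWith⁺)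
open import Data.List.Membership.Propositional.Properties.WithK using (unique∧set⇒bag)
open import Data.List.Properties using (map-++; map-∘; map-cong; map-applyUpTo)
open import Data.List.Relation.Binary.BagAndSetEquality using (∼bag⇒↭)
open import Data.List.Relation.Binary.Permutation.Propositional using (_↭_)
import Data.List.Relation.Binary.Permutation.Propositional.Properties as ↭
open import Data.List.Relation.Unary.All using ([])
open import Data.List.Relation.Unary.Any using (here)
open import Data.List.Relation.Unary.Unique.Propositional using (Unique; []; _∷_)
import Data.List.Relation.Unary.Unique.Propositional.Properties as Unique
open import Data.Nat as ℕ using (ℕ; zero; suc; _∸_; _≤_; _<_; z≤n; s≤s)
open import Data.Nat.ListAction using (sum)
open import Data.Nat.ListAction.Properties using (sum-++; sum-↭)
import Data.Nat.Properties as ℕ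
open import Data.Product using (∃; _×_; _,_; proj₁; proj₂)
open import Data.Sum using (inj₁; inj₂)
open import Data.Vec as Vec using (Vec; []; _∷_)
import Data.Vec.Properties as Vec
open import Data.Vec.Relation.Unary.Linked as Linked using (Linked; []; [-]; _∷_)
import Data.Vec.Relation.Unary.Linked.Properties as Linked
open import Function using (_∘_; _⇔_; mk⇔; Equivalence)
open import Relation.Binary.PropositionalEquality
  using (_≡_; refl; sym; trans; cong; cong₂; subst; module ≡-Reasoning)
open import Relation.Nullary using (yes; no)

open ≡-Reasoning

-- Sums over lists and integer intervals

sum-map-+ : ∀ {A : Set} (f g : A → ℕ) xs →
            sum (map (λ x → f x ℕ.+ g x) xs) ≡ sum (map f xs) ℕ.+ sum (map g xs)
sum-map-+ f g []       = refl
sum-map-+ f g (x ∷ xs) = trans (cong (f x ℕ.+ g x ℕ.+_) (sum-map-+ f g xs))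
  (interchange ℕ.+-commutativeSemigroup (f x) (g x) _ _)

applyUpTo-cong : ∀ {A : Set} {f g : ℕ → A} → (∀ i → f i ≡ g i) →
                 ∀ n → applyUpTo f n ≡ applyUpTo g n
applyUpTo-cong f≗g zero    = refl
applyUpTo-cong f≗g (suc n) = cong₂ _∷_ (f≗g 0) (applyUpTo-cong (f≗g ∘ suc) n)

⋯-suc : ∀ a b → [ ℤ.suc a ⋯ ℤ.suc b ] ≡ map ℤ.suc [ a ⋯ b ]
⋯-suc a b = begin
  applyUpTo (λ i → ℤ.suc a ℤ.+ + i) ℤ.∣ (ℤ.suc (ℤ.suc b) ℤ.- ℤ.suc a) ℤ.⊔ 0ℤ ∣
    ≡⟨ applyUpTo-cong (λ i → ℤ.+-assoc 1ℤ a (+ i)) _ ⟩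
  applyUpTo (λ i → ℤ.suc (a ℤ.+ + i)) ℤ.∣ (ℤ.suc (ℤ.suc b) ℤ.- ℤ.suc a) ℤ.⊔ 0ℤ ∣
    ≡⟨ cong (λ l → applyUpTo _ ℤ.∣ l ℤ.⊔ 0ℤ ∣) (length-suc a b) ⟩
  applyUpTo (λ i → ℤ.suc (a ℤ.+ + i)) ℤ.∣ (ℤ.suc b ℤ.- a) ℤ.⊔ 0ℤ ∣
    ≡⟨ map-applyUpTo (λ i → a ℤ.+ + i) ℤ.suc _ ⟨
  map ℤ.suc [ a ⋯ b ] ∎
  where
  length-suc : ∀ a b → (1ℤ ℤ.+ (1ℤ ℤ.+ b)) ℤ.- (1ℤ ℤ.+ a) ≡ (1ℤ ℤ.+ b) ℤ.- a
  length-suc = ℤ.solve-∀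

-suc⋯0 : ∀ j → [ ℤ.- (+ suc j) ⋯ 0ℤ ] ≡ ℤ.- (+ suc j) ∷ [ ℤ.- (+ j) ⋯ 0ℤ ]
-suc⋯0 zero    = refl
-- Head and length agree by computation; in the tail, (1 + i) - (j + 2) has to become i - (j + 1).
-suc⋯0 (suc j) = cong (-[1+ suc j ] ∷_)
  (applyUpTo-cong (λ i → ℤ.[1+m]⊖[1+n]≡m⊖n i (suc j)) (suc (suc j)))

-- Inner sums and the slices of fixed d₀

-- Translation invariance: all limits move by 1, hence so do all the summation variables.
innerSum-suc : ∀ {r} d (c : Vec ℕ r) → innerSum (ℤ.suc d) (Vec.map suc c) ≡ innerSum d c
innerSum-suc d []       = refl
innerSum-suc d (c ∷ cs) = cong sum (begin
  map (λ d′ → innerSum d′ (Vec.map suc cs)) [ ℤ.suc d ⋯ ℤ.suc (+ c) ]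
    ≡⟨ cong (map _) (⋯-suc d (+ c)) ⟩
  map (λ d′ → innerSum d′ (Vec.map suc cs)) (map ℤ.suc [ d ⋯ + c ])
    ≡⟨ map-∘ [ d ⋯ + c ] ⟨
  map (λ d′ → innerSum (ℤ.suc d′) (Vec.map suc cs)) [ d ⋯ + c ]
    ≡⟨ map-cong (λ d′ → innerSum-suc d′ cs) [ d ⋯ + c ] ⟩
  map (λ d′ → innerSum d′ cs) [ d ⋯ + c ] ∎)

-- The part of α r k e with d₀ = -e.
β : (r k e : ℕ) → ℕ
β r k e = sum (map (innerSum (ℤ.- (+ e))) (summationIndices r k))

α-zero : ∀ r k → α r k 0 ≡ β r k 0
α-zero r k = cong sum (map-cong (λ c → ℕ.+-identityʳ (innerSum 0ℤ c)) (summationIndices r k))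

-- The lowest value d₀ = -(j + 1) is split off, leaving the range for j. For generating functions,
-- this says that multiplying by 1 - y isolates the slice `β`.
α-suc : ∀ r k j → α r k (suc j) ≡ β r k (suc j) ℕ.+ α r k j
α-suc r k j = trans
  (cong sum (map-cong (λ c → cong (λ ds → sum (map (λ d → innerSum d c) ds)) (-suc⋯0 j))
                      (summationIndices r k)))
  (sum-map-+ (innerSum (ℤ.- (+ suc j))) _ (summationIndices r k))

-- Summation indices and their splitting by c₁

∈-boundedTuples : ∀ {r k} (c : Vec ℕ r) → Vec.sum c ≤ k → c ∈ boundedTuples r k
∈-boundedTuples []       _ = here refl
∈-boundedTuples (c ∷ cs) p = ∈-cartesianProductWith⁺ _∷_
  (∈-upTo⁺ (s≤s (ℕ.m+n≤o⇒m≤o c p))) (∈-boundedTuples cs (ℕ.m+n≤o⇒n≤o c p))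

-- Together with the absence of duplicates, this determines the list up to permutation, hence all
-- sums over it.
∈-summationIndices : ∀ {r k} {c : Vec ℕ r} → c ∈ summationIndices r k ⇔ IsSummationIndex k c
∈-summationIndices {r} {k} {c} = mk⇔
  (λ c∈ → proj₂ (∈-filter⁻ (isSummationIndex? k) {xs = boundedTuples r k} c∈))
  (λ p → ∈-filter⁺ (isSummationIndex? k) (∈-boundedTuples c (ℕ.≤-reflexive (proj₁ p))) p)

boundedTuples-unique : ∀ r k → Unique (boundedTuples r k)
boundedTuples-unique zero    k = [] ∷ []
boundedTuples-unique (suc r) k =
  Unique.cartesianProductWith⁺ _∷_ Vec.∷-injective (Unique.upTo⁺ (suc k)) (boundedTuples-unique r k)

summationIndices-unique : ∀ r k → Unique (summationIndices r k)
summationIndices-unique r k = Unique.filter⁺ (isSummationIndex? k) (boundedTuples-unique r k)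

sum-map-suc : ∀ {r} (c : Vec ℕ r) → Vec.sum (Vec.map suc c) ≡ r ℕ.+ Vec.sum c
sum-map-suc         []       = refl
sum-map-suc {suc r} (c ∷ cs) = cong suc (begin
  c ℕ.+ Vec.sum (Vec.map suc cs)  ≡⟨ cong (c ℕ.+_) (sum-map-suc cs) ⟩
  c ℕ.+ (r ℕ.+ Vec.sum cs)        ≡⟨ ℕ.+-assoc c r _ ⟨
  c ℕ.+ r ℕ.+ Vec.sum cs          ≡⟨ cong (ℕ._+ Vec.sum cs) (ℕ.+-comm c r) ⟩
  r ℕ.+ c ℕ.+ Vec.sum cs          ≡⟨ ℕ.+-assoc r c _ ⟩
  r ℕ.+ (c ℕ.+ Vec.sum cs)        ∎)

IsSummationIndex-suc : ∀ {r k} (c : Vec ℕ r) →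
                       IsSummationIndex (r ℕ.+ k) (Vec.map suc c) ⇔ IsSummationIndex k c
IsSummationIndex-suc {r} c = mk⇔
  (λ (p , q) → ℕ.+-cancelˡ-≡ r _ _ (trans (sym (sum-map-suc c)) p)
             , Linked.map ℕ.s≤s⁻¹ (Linked.map⁻ q))
  (λ (p , q) → trans (sum-map-suc c) (cong (r ℕ.+_) p) , Linked.map⁺ (Linked.map s≤s q))

Linked-0∷ : ∀ {r} {c : Vec ℕ r} → Linked _≤_ c → Linked _≤_ (0 ∷ c)
Linked-0∷ []         = [-]
Linked-0∷ [-]        = z≤n ∷ [-]
Linked-0∷ (x≤y ∷ ls) = z≤n ∷ x≤y ∷ ls

-- The first entry is the smallest, so once it is positive the whole tuple can be lowered by 1.
Linked-suc∷ : ∀ {r x} {c : Vec ℕ r} → Linked _≤_ (suc x ∷ c) →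
              ∃ λ c′ → suc x ∷ c ≡ Vec.map suc c′
Linked-suc∷ {x = x} [-] = x ∷ [] , refl
Linked-suc∷ {x = x} {suc y ∷ c} (_ ∷ ls) with c′ , eq ← Linked-suc∷ ls = x ∷ c′ , cong (suc x ∷_) eq

map-suc-injective : ∀ {r} {c c′ : Vec ℕ r} → Vec.map suc c ≡ Vec.map suc c′ → c ≡ c′
map-suc-injective {c = []}    {[]}    _  = refl
map-suc-injective {c = _ ∷ _} {_ ∷ _} eq =
  cong₂ _∷_ (ℕ.suc-injective (Vec.∷-injectiveˡ eq)) (map-suc-injective (Vec.∷-injectiveʳ eq))

-- The two parts are the indices with c₁ = 0 and with c₁ > 0. Keeping `cs` abstract lets one proof
-- serve both k < r + 1, where `cs` is empty, and k ≥ r + 1, where it lists the indices for k - (r +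
-- 1).
summationIndices-split :
  ∀ {r k} {cs : List (Vec ℕ (suc r))} → Unique cs →
  (∀ {c} → c ∈ cs ⇔ IsSummationIndex k (Vec.map suc c)) →
  summationIndices (suc r) k ↭ map (0 ∷_) (summationIndices r k) ++ map (Vec.map suc) cs
summationIndices-split {r} {k} {cs} cs! cs-spec = ∼bag⇒↭ (unique∧set⇒bag
  (summationIndices-unique (suc r) k)
  (Unique.++⁺ (Unique.map⁺ Vec.∷-injectiveʳ (summationIndices-unique r k))
              (Unique.map⁺ map-suc-injective cs!) disjoint)
  (mk⇔ to from))
  where
  open Equivalence using () renaming (to to ⇒; from to ⇐)

  disjoint : ∀ {c} → c ∈ map (0 ∷_) (summationIndices r k) × c ∈ map (Vec.map suc) cs → ⊥
  disjoint (p , q) with _ , _ , refl ← ∈-map⁻ (0 ∷_) p | (_ ∷ _) , _ , () ← ∈-map⁻ (Vec.map suc) q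

  to : ∀ {c} → c ∈ summationIndices (suc r) k →
       c ∈ map (0 ∷_) (summationIndices r k) ++ map (Vec.map suc) cs
  to {zero ∷ _} c∈ with p , q ← ⇒ ∈-summationIndices c∈ =
    ∈-++⁺ˡ (∈-map⁺ (0 ∷_) (⇐ ∈-summationIndices (p , Linked.tail q)))
  to {suc _ ∷ _} c∈ with p , q ← ⇒ ∈-summationIndices c∈ with c′ , eq ← Linked-suc∷ q =
    ∈-++⁺ʳ (map (0 ∷_) (summationIndices r k))
      (subst (_∈ map (Vec.map suc) cs) (sym eq)
        (∈-map⁺ (Vec.map suc) (⇐ cs-spec (subst (IsSummationIndex k) eq (p , q)))))

  from : ∀ {c} → c ∈ map (0 ∷_) (summationIndices r k) ++ map (Vec.map suc) cs →
         c ∈ summationIndices (suc r) k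
  from c∈ with ∈-++⁻ (map (0 ∷_) (summationIndices r k)) c∈
  ... | inj₁ p with _ , c′∈ , refl ← ∈-map⁻ (0 ∷_) p with s , l ← ⇒ ∈-summationIndices c′∈ =
    ⇐ ∈-summationIndices (s , Linked-0∷ l)
  ... | inj₂ p with _ , c′∈ , refl ← ∈-map⁻ (Vec.map suc) p =
    ⇐ ∈-summationIndices (⇒ cs-spec c′∈)

suc-neg-suc : ∀ e → ℤ.suc (ℤ.- (+ suc e)) ≡ ℤ.- (+ e)
suc-neg-suc zero    = refl
suc-neg-suc (suc e) = refl

β-split : ∀ {r k} {cs : List (Vec ℕ (suc r))} → Unique cs →
          (∀ {c} → c ∈ cs ⇔ IsSummationIndex k (Vec.map suc c)) →
          ∀ e → β (suc r) k e ≡ α r k e ℕ.+ sum (map (innerSum (ℤ.- (+ suc e))) cs)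
β-split {r} {k} {cs} cs! cs-spec e = begin
  sum (map S (summationIndices (suc r) k))
    ≡⟨ sum-↭ (↭.map⁺ S (summationIndices-split cs! cs-spec)) ⟩
  sum (map S (map (0 ∷_) (summationIndices r k) ++ map (Vec.map suc) cs))
    ≡⟨ cong sum (map-++ S (map (0 ∷_) (summationIndices r k)) (map (Vec.map suc) cs)) ⟩
  sum (map S (map (0 ∷_) (summationIndices r k)) ++ map S (map (Vec.map suc) cs))
    ≡⟨ sum-++ (map S (map (0 ∷_) (summationIndices r k))) _ ⟩
  sum (map S (map (0 ∷_) (summationIndices r k))) ℕ.+ sum (map S (map (Vec.map suc) cs))
    -- `S (0 ∷ c)` unfolds to a sum over d₁ from -e to 0, so d₁ takes the role of d₀ and the first
    -- summand is `α r k e` by definition.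
    ≡⟨ cong₂ ℕ._+_ (cong sum (sym (map-∘ (summationIndices r k)))) (cong sum (sym (map-∘ cs))) ⟩
  α r k e ℕ.+ sum (map (S ∘ Vec.map suc) cs)
    ≡⟨ cong (λ l → α r k e ℕ.+ sum l) (map-cong S-suc cs) ⟩
  α r k e ℕ.+ sum (map (innerSum (ℤ.- (+ suc e))) cs) ∎
  where
  S : ∀ {r} → Vec ℕ r → ℕ
  S = innerSum (ℤ.- (+ e))

  S-suc : ∀ c → S (Vec.map suc c) ≡ innerSum (ℤ.- (+ suc e)) c
  S-suc c = trans (cong (λ d → innerSum d (Vec.map suc c)) (sym (suc-neg-suc e)))
                  (innerSum-suc (ℤ.- (+ suc e)) c)

-- Raising r + 1 entries by 1 gives a sum of at least r + 1, so for smaller k no index has c₁ > 0.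
β-< : ∀ {r k} → k < suc r → ∀ e → β (suc r) k e ≡ α r k e
β-< {r} {k} k<1+r e = trans (β-split [] (mk⇔ (λ ()) absurd) e) (ℕ.+-identityʳ _)
  where
  absurd : ∀ {c} → IsSummationIndex k (Vec.map suc c) → c ∈ []
  absurd {c} (p , _) = ⊥-elim (ℕ.m+n≮m (suc r) (Vec.sum c)
    (subst (_< suc r) (trans (sym p) (sum-map-suc c)) k<1+r))

-- Lowering an index with c₁ > 0 takes r + 1 from its sum and moves the lower limit from -e to -(e +
-- 1): the factor x^(r+1) / y.
β-+ : ∀ r k e → β (suc r) (suc r ℕ.+ k) e ≡ α r (suc r ℕ.+ k) e ℕ.+ β (suc r) k (suc e)
β-+ r k = β-split (summationIndices-unique (suc r) k) (λ {c} → mk⇔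
  (⇐ (IsSummationIndex-suc c) ∘ ⇒ ∈-summationIndices)
  (⇐ ∈-summationIndices ∘ ⇒ (IsSummationIndex-suc c)))
  where open Equivalence using () renaming (to to ⇒; from to ⇐)

-- Finite sums of integers

∑-cong : ∀ n {f g : ℕ → ℤ} → (∀ i → i ≤ n → f i ≡ g i) → ∑≤ n f ≡ ∑≤ n g
∑-cong zero    f≗g = f≗g 0 z≤n
∑-cong (suc n) f≗g =
  cong₂ ℤ._+_ (∑-cong n (λ i i≤n → f≗g i (ℕ.m≤n⇒m≤1+n i≤n))) (f≗g (suc n) ℕ.≤-refl)

∑-zero : ∀ n → ∑≤ n (λ _ → 0ℤ) ≡ 0ℤ
∑-zero zero    = refl
∑-zero (suc n) = cong (ℤ._+ 0ℤ) (∑-zero n)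

∑-last : ∀ n {f : ℕ → ℤ} → (∀ i → i < n → f i ≡ 0ℤ) → ∑≤ n f ≡ f n
∑-last zero        f≡0 = refl
∑-last (suc n) {f} f≡0 = trans
  (cong (ℤ._+ f (suc n)) (trans (∑-cong n (λ i i≤n → f≡0 i (s≤s i≤n))) (∑-zero n)))
  (ℤ.+-identityˡ _)

∑-minus : ∀ n (f g : ℕ → ℤ) → ∑≤ n (λ i → f i ℤ.- g i) ≡ ∑≤ n f ℤ.- ∑≤ n g
∑-minus zero    f g = refl
∑-minus (suc n) f g = trans (cong (ℤ._+ (f (suc n) ℤ.- g (suc n))) (∑-minus n f g))
                        (regroup (∑≤ n f) (∑≤ n g) (f (suc n)) (g (suc n)))
  where
  regroup : ∀ a b c d → (a ℤ.- b) ℤ.+ (c ℤ.- d) ≡ (a ℤ.+ c) ℤ.- (b ℤ.+ d)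
  regroup = ℤ.solve-∀

-- Shifts of coefficient sequences

-- The coefficients of t^N u(t).
shift : ℕ → (ℕ → ℤ) → ℕ → ℤ
shift zero    u m       = u m
shift (suc N) u zero    = 0ℤ
shift (suc N) u (suc m) = shift N u m

shift-cong : ∀ N {u v : ℕ → ℤ} → (∀ m → u m ≡ v m) → ∀ m → shift N u m ≡ shift N v m
shift-cong zero    u≗v m       = u≗v m
shift-cong (suc N) u≗v zero    = refl
shift-cong (suc N) u≗v (suc m) = shift-cong N u≗v m

shift-map : ∀ N (φ : ℤ → ℤ) → φ 0ℤ ≡ 0ℤ → ∀ u m → φ (shift N u m) ≡ shift N (φ ∘ u) m
shift-map zero    φ φ0 u m       = refl
shift-map (suc N) φ φ0 u zero    = φ0
shift-map (suc N) φ φ0 u (suc m) = shift-map N φ φ0 u m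

shift-0 : ∀ N m → shift N (λ _ → 0ℤ) m ≡ 0ℤ
shift-0 N m = sym (shift-map N (λ _ → 0ℤ) refl (λ _ → 0ℤ) m)

shift-+ : ∀ N u v m → shift N (λ i → u i ℤ.+ v i) m ≡ shift N u m ℤ.+ shift N v m
shift-+ zero    u v m       = refl
shift-+ (suc N) u v zero    = refl
shift-+ (suc N) u v (suc m) = shift-+ N u v m

shift-∑ : ∀ N n (u : ℕ → ℕ → ℤ) m →
          ∑≤ n (λ i → shift N (u i) m) ≡ shift N (λ m → ∑≤ n (λ i → u i m)) m
shift-∑ zero    n u m       = refl
shift-∑ (suc N) n u zero    = ∑-zero n
shift-∑ (suc N) n u (suc m) = shift-∑ N n u m

-- The order `N + M` matches the unfolding of `suc j * N` to `N + j * N`.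
shift-shift : ∀ M N u m → shift M (shift N u) m ≡ shift (N ℕ.+ M) u m
shift-shift M N u m rewrite ℕ.+-comm N M = go M m
  where
  go : ∀ M m → shift M (shift N u) m ≡ shift (M ℕ.+ N) u m
  go zero    m       = refl
  go (suc M) zero    = refl
  go (suc M) (suc m) = go M m

shift-< : ∀ {N m} → m < N → ∀ u → shift N u m ≡ 0ℤ
shift-< {suc N} {zero}  _         u = refl
shift-< {suc N} {suc m} (s≤s m<N) u = shift-< m<N u

shift-at-+ : ∀ N u m → shift N u (N ℕ.+ m) ≡ u m
shift-at-+ zero    u m = refl
shift-at-+ (suc N) u m = shift-at-+ N u m

-- The family `w i` carries the left factor's coefficient at i, so this moves a power of the
-- variable out of a Cauchy product.
shift-conv : ∀ N (w : ℕ → ℕ → ℤ) m →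
             ∑≤ m (λ i → shift N (w i) (m ∸ i)) ≡ shift N (λ m → ∑≤ m (λ i → w i (m ∸ i))) m
shift-conv zero    w m       = refl
shift-conv (suc N) w zero    = refl
shift-conv (suc N) w (suc m) = begin
  ∑≤ m (λ i → shift (suc N) (w i) (suc m ∸ i)) ℤ.+ shift (suc N) (w (suc m)) (m ∸ m)
    -- The term i = m + 1 is read at index 0, where a positive shift is 0.
    ≡⟨ cong₂ ℤ._+_ (∑-cong m (λ i i≤m → cong (shift (suc N) (w i)) (ℕ.+-∸-assoc 1 i≤m)))
                   (cong (shift (suc N) (w (suc m))) (ℕ.n∸n≡0 m)) ⟩
  ∑≤ m (λ i → shift N (w i) (m ∸ i)) ℤ.+ 0ℤ
    ≡⟨ ℤ.+-identityʳ _ ⟩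
  ∑≤ m (λ i → shift N (w i) (m ∸ i))
    ≡⟨ shift-conv N w m ⟩
  shift N (λ m → ∑≤ m (λ i → w i (m ∸ i))) m ∎

-- Products of series; multiplication by powers of x and y as shifts

shiftX shiftY : ℕ → Series → Series
shiftX N f m n = shift N (λ m → f m n) m
shiftY N f m n = shift N (f m) n

⊛-congˡ : ∀ f {g h} → g ≈ h → f ⊛ g ≈ f ⊛ h
⊛-congˡ f g≈h m n =
  ∑-cong m (λ i _ → ∑-cong n (λ j _ → cong (f i j ℤ.*_) (g≈h (m ∸ i) (n ∸ j))))

⊛-distribˡ-⊖ : ∀ f g h → f ⊛ (g ⊖ h) ≈ f ⊛ g ⊖ f ⊛ h
⊛-distribˡ-⊖ f g h m n = begin
  (∑≤ m λ i → ∑≤ n λ j → f i j ℤ.* (g (m ∸ i) (n ∸ j) ℤ.- h (m ∸ i) (n ∸ j)))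
    ≡⟨ ∑-cong m (λ i _ → trans
         (∑-cong n (λ j _ → distrib (f i j) (g (m ∸ i) (n ∸ j)) (h (m ∸ i) (n ∸ j))))
         (∑-minus n _ _)) ⟩
  (∑≤ m λ i → (∑≤ n λ j → f i j ℤ.* g (m ∸ i) (n ∸ j)) ℤ.- (∑≤ n λ j → f i j ℤ.* h (m ∸ i) (n ∸ j)))
    ≡⟨ ∑-minus m _ _ ⟩
  (f ⊛ g ⊖ f ⊛ h) m n ∎
  where
  distrib : ∀ a b c → a ℤ.* (b ℤ.- c) ≡ a ℤ.* b ℤ.- a ℤ.* c
  distrib = ℤ.solve-∀

⊛-identityʳ : ∀ f → f ⊛ 𝟙 ≈ f
⊛-identityʳ f m n = begin
  (∑≤ m λ i → ∑≤ n λ j → f i j ℤ.* 𝟙 (m ∸ i) (n ∸ j))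
    ≡⟨ ∑-last m (λ i i<m → trans
         (∑-cong n (λ j _ → trans (cong (f i j ℤ.*_) (𝟙-off-x (n ∸ j) (ℕ.m<n⇒0<n∸m i<m)))
                                  (ℤ.*-zeroʳ (f i j))))
         (∑-zero n)) ⟩
  (∑≤ n λ j → f m j ℤ.* 𝟙 (m ∸ m) (n ∸ j))
    ≡⟨ ∑-last n (λ j j<n → trans (cong (f m j ℤ.*_) (𝟙-off-y (m ∸ m) (ℕ.m<n⇒0<n∸m j<n)))
                                 (ℤ.*-zeroʳ (f m j))) ⟩
  f m n ℤ.* 𝟙 (m ∸ m) (n ∸ n)
    ≡⟨ cong₂ (λ a b → f m n ℤ.* 𝟙 a b) (ℕ.n∸n≡0 m) (ℕ.n∸n≡0 n) ⟩
  f m n ℤ.* 1ℤ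
    ≡⟨ ℤ.*-identityʳ (f m n) ⟩
  f m n ∎
  where
  𝟙-off-x : ∀ {a} b → 0 < a → 𝟙 a b ≡ 0ℤ
  𝟙-off-x {suc a} b _ = refl

  𝟙-off-y : ∀ a {b} → 0 < b → 𝟙 a b ≡ 0ℤ
  𝟙-off-y zero    {suc b} _ = refl
  𝟙-off-y (suc a) {suc b} _ = refl

-- The inner sum runs over y-degrees, so the shift passes it termwise; the outer one is the
-- convolution in x. For `⊛-shiftY` these roles are exchanged.
⊛-shiftX : ∀ N f g → f ⊛ shiftX N g ≈ shiftX N (f ⊛ g)
⊛-shiftX N f g m n = trans
  (∑-cong m λ i _ → trans
    (∑-cong n λ j _ → shift-map N (f i j ℤ.*_) (ℤ.*-zeroʳ (f i j)) _ (m ∸ i))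
    (shift-∑ N n (λ j m′ → f i j ℤ.* g m′ (n ∸ j)) (m ∸ i)))
  (shift-conv N (λ i m′ → ∑≤ n λ j → f i j ℤ.* g m′ (n ∸ j)) m)

⊛-shiftY : ∀ N f g → f ⊛ shiftY N g ≈ shiftY N (f ⊛ g)
⊛-shiftY N f g m n = trans
  (∑-cong m λ i _ → trans
    (∑-cong n λ j _ → shift-map N (f i j ℤ.*_) (ℤ.*-zeroʳ (f i j)) _ (n ∸ j))
    (shift-conv N (λ j n′ → f i j ℤ.* g (m ∸ i) n′) n))
  (shift-∑ N m (λ i n → ∑≤ n λ j → f i j ℤ.* g (m ∸ i) (n ∸ j)) n)

X≈shiftX : X ≈ shiftX 1 𝟙
X≈shiftX zero          n       = refl
X≈shiftX (suc zero)    zero    = refl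
X≈shiftX (suc zero)    (suc n) = refl
X≈shiftX (suc (suc m)) n       = refl

Y≈shiftY : Y ≈ shiftY 1 𝟙
Y≈shiftY zero    zero          = refl
Y≈shiftY zero    (suc zero)    = refl
Y≈shiftY zero    (suc (suc n)) = refl
Y≈shiftY (suc m) zero          = refl
Y≈shiftY (suc m) (suc n)       = refl

⊛-≈shiftX : ∀ N f {g} → g ≈ shiftX N 𝟙 → f ⊛ g ≈ shiftX N f
⊛-≈shiftX N f g≈ m n = trans (⊛-congˡ f g≈ m n) (trans (⊛-shiftX N f 𝟙 m n)
  (shift-cong N (λ m → ⊛-identityʳ f m n) m))

⊛-Y : ∀ f → f ⊛ Y ≈ shiftY 1 f
⊛-Y f m n = trans (⊛-congˡ f Y≈shiftY m n) (trans (⊛-shiftY 1 f 𝟙 m n)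
  (shift-cong 1 (⊛-identityʳ f m) n))

-- Serves both for the powers of x and for the powers of x^N in the substitution.
^-≈shiftX : ∀ N {g} → g ≈ shiftX N 𝟙 → ∀ j → g ^ j ≈ shiftX (j ℕ.* N) 𝟙
^-≈shiftX N         g≈ zero    m n = refl
^-≈shiftX N {g = g} g≈ (suc j) m n = begin
  (g ⊛ g ^ j) m n                        ≡⟨ ⊛-≈shiftX (j ℕ.* N) g (^-≈shiftX N g≈ j) m n ⟩
  shiftX (j ℕ.* N) g m n                 ≡⟨ shift-cong (j ℕ.* N) (λ m → g≈ m n) m ⟩
  shiftX (j ℕ.* N) (shiftX N 𝟙) m n      ≡⟨ shift-shift (j ℕ.* N) N _ m ⟩
  shiftX (suc j ℕ.* N) 𝟙 m n             ∎

X^≈shiftX : ∀ N → X ^ N ≈ shiftX N 𝟙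
X^≈shiftX N = subst (λ k → X ^ N ≈ shiftX k 𝟙) (ℕ.*-identityʳ N) (^-≈shiftX 1 X≈shiftX N)

⊛-𝟙⊖Y : ∀ f → f ⊛ (𝟙 ⊖ Y) ≈ f ⊖ shiftY 1 f
⊛-𝟙⊖Y f m n = trans (⊛-distribˡ-⊖ f 𝟙 Y m n) (cong₂ ℤ._-_ (⊛-identityʳ f m n) (⊛-Y f m n))

-- Right multiplication by 1 - y is g ↦ g - y g, which commutes with left multiplication by f.
⊛-assoc-𝟙⊖Y : ∀ f g → f ⊛ (g ⊛ (𝟙 ⊖ Y)) ≈ f ⊛ g ⊖ shiftY 1 (f ⊛ g)
⊛-assoc-𝟙⊖Y f g m n = begin
  (f ⊛ (g ⊛ (𝟙 ⊖ Y))) m n           ≡⟨ ⊛-congˡ f (⊛-𝟙⊖Y g) m n ⟩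
  (f ⊛ (g ⊖ shiftY 1 g)) m n        ≡⟨ ⊛-distribˡ-⊖ f g (shiftY 1 g) m n ⟩
  (f ⊛ g ⊖ f ⊛ shiftY 1 g) m n      ≡⟨ cong (λ z → (f ⊛ g) m n ℤ.- z) (⊛-shiftY 1 f g m n) ⟩
  (f ⊛ g ⊖ shiftY 1 (f ⊛ g)) m n    ∎

-- Substitution of x^N for y

[y≔X^] : ∀ f N m n → (f [y≔ X ^ N ]) m n ≡
         ∑≤ (m ℕ.+ n) (λ j → shiftX (j ℕ.* N) (coeffY f j) m n)
[y≔X^] f N m n = ∑-cong (m ℕ.+ n) λ j _ →
  ⊛-≈shiftX (j ℕ.* N) (coeffY f j) (^-≈shiftX N (X^≈shiftX N) j) m n

-- The substituted series is free of y: each `coeffY f j` is, and shifts in x preserve this.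
[y≔X^]-suc : ∀ f N m n → (f [y≔ X ^ N ]) m (suc n) ≡ 0ℤ
[y≔X^]-suc f N m n = begin
  (f [y≔ X ^ N ]) m (suc n)
    ≡⟨ [y≔X^] f N m (suc n) ⟩
  ∑≤ (m ℕ.+ suc n) (λ j → shift (j ℕ.* N) (λ _ → 0ℤ) m)
    ≡⟨ ∑-cong (m ℕ.+ suc n) (λ j _ → shift-0 (j ℕ.* N) m) ⟩
  ∑≤ (m ℕ.+ suc n) (λ _ → 0ℤ)
    ≡⟨ ∑-zero (m ℕ.+ suc n) ⟩
  0ℤ ∎

-- Solving b = f + x^N (b - b(x, 0)) / y

module _ {f b : Series} (N : ℕ) .{{_ : ℕ.NonZero N}}
         (b-rec : ∀ m n → b m n ≡ f m n ℤ.+ shift N (λ m → b m (suc n)) m) where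

  -- `b-rec` is unrolled K + 1 times from y^0. Each step contributes a factor x^N and raises the
  -- y-degree by 1; the last term is the remainder.
  b₀-expand : ∀ K m → b m 0 ≡ ∑≤ K (λ j → shift (j ℕ.* N) (λ m → f m j) m)
                              ℤ.+ shift (suc K ℕ.* N) (λ m → b m (suc K)) m
  b₀-expand zero m rewrite ℕ.+-identityʳ N = b-rec m 0
  b₀-expand (suc K) m = begin
    b m 0
      ≡⟨ b₀-expand K m ⟩
    S ℤ.+ shift M (λ m → b m (suc K)) m
      ≡⟨ cong (λ z → S ℤ.+ z) (shift-cong M (λ m → b-rec m (suc K)) m) ⟩
    S ℤ.+ shift M (λ m → f m (suc K) ℤ.+ shift N (λ m → b m (suc (suc K))) m) m
      ≡⟨ cong (λ z → S ℤ.+ z) (shift-+ M _ _ m) ⟩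
    S ℤ.+ (shift M (λ m → f m (suc K)) m ℤ.+ shift M (shift N (λ m → b m (suc (suc K)))) m)
      ≡⟨ cong (λ z → S ℤ.+ (shift M (λ m → f m (suc K)) m ℤ.+ z)) (shift-shift M N _ m) ⟩
    S ℤ.+ (shift M (λ m → f m (suc K)) m ℤ.+ shift (suc (suc K) ℕ.* N) (λ m → b m (suc (suc K))) m)
      ≡⟨ ℤ.+-assoc S _ _ ⟨
    ∑≤ (suc K) (λ j → shift (j ℕ.* N) (λ m → f m j) m)
      ℤ.+ shift (suc (suc K) ℕ.* N) (λ m → b m (suc (suc K))) m ∎
    where
    M = suc K ℕ.* N
    S = ∑≤ K (λ j → shift (j ℕ.* N) (λ m → f m j) m)

  b₀≡[y≔X^] : ∀ m → b m 0 ≡ (f [y≔ X ^ N ]) m 0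
  b₀≡[y≔X^] m = begin
    b m 0
      ≡⟨ b₀-expand K m ⟩
    S ℤ.+ shift (suc K ℕ.* N) (λ m → b m (suc K)) m
      ≡⟨ cong (λ z → S ℤ.+ z) (shift-< m<KN _) ⟩
    S ℤ.+ 0ℤ
      ≡⟨ ℤ.+-identityʳ S ⟩
    S
      ≡⟨ [y≔X^] f N m 0 ⟨
    (f [y≔ X ^ N ]) m 0 ∎
    where
    -- The point where the substitution truncates its sum for the coefficient of x^m y^0.
    K = m ℕ.+ 0
    S = ∑≤ K (λ j → shift (j ℕ.* N) (λ m → f m j) m)

    -- As N ≥ 1, the remainder has x-degree at least K + 1 > m.
    m<KN : m < suc K ℕ.* N
    m<KN = ℕ.≤-trans (s≤s (ℕ.m≤m+n m 0)) (ℕ.m≤m*n (suc K) N)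

  -- The left side is (x^N - y) b. At y^0 the claim is b(x, 0) = f(x, x^N) times x^N; at y^(n+1) the
  -- coefficients of b cancel by `b-rec`.
  shift-recursion : shiftX N b ⊖ shiftY 1 b ≈ f [y≔ X ^ N ] ⊛ X ^ N ⊖ f ⊛ Y
  shift-recursion m n = trans (go m n) (sym (cong₂ ℤ._-_
      (⊛-≈shiftX N (f [y≔ X ^ N ]) (X^≈shiftX N) m n) (⊛-Y f m n)))
    where
    cancel : ∀ a s → s ℤ.- (a ℤ.+ s) ≡ 0ℤ ℤ.- a
    cancel = ℤ.solve-∀

    go : shiftX N b ⊖ shiftY 1 b ≈ shiftX N (f [y≔ X ^ N ]) ⊖ shiftY 1 f
    go m zero    = cong (ℤ._- 0ℤ) (shift-cong N b₀≡[y≔X^] m)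
    go m (suc n) = begin
      shift N (λ m → b m (suc n)) m ℤ.- b m n
        ≡⟨ cong (λ z → shift N (λ m → b m (suc n)) m ℤ.- z) (b-rec m n) ⟩
      shift N (λ m → b m (suc n)) m ℤ.- (f m n ℤ.+ shift N (λ m → b m (suc n)) m)
        ≡⟨ cancel (f m n) (shift N (λ m → b m (suc n)) m) ⟩
      0ℤ ℤ.- f m n
        -- `0ℤ` is the coefficient at y^(n+1) of x^N f(x, x^N), which is free of y.
        ≡⟨ cong (ℤ._- f m n) (trans (sym (shift-0 N m))
             (shift-cong N (λ m → sym ([y≔X^]-suc f N m n)) m)) ⟩
      shift N (λ m → (f [y≔ X ^ N ]) m (suc n)) m ℤ.- f m n ∎

-- The hypothesis is (1 - y) g = b in coefficients, so both sides are (x^N - y) b.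
⊛-[X^⊖Y]-[𝟙⊖Y] : ∀ N {g b} → (∀ m n → g m n ≡ b m n ℤ.+ shiftY 1 g m n) →
                 g ⊛ ((X ^ N ⊖ Y) ⊛ (𝟙 ⊖ Y)) ≈ shiftX N b ⊖ shiftY 1 b
⊛-[X^⊖Y]-[𝟙⊖Y] N {g} {b} g-rec m n = begin
  (g ⊛ ((X ^ N ⊖ Y) ⊛ (𝟙 ⊖ Y))) m n
    ≡⟨ ⊛-assoc-𝟙⊖Y g (X ^ N ⊖ Y) m n ⟩
  (g ⊛ (X ^ N ⊖ Y) ⊖ shiftY 1 (g ⊛ (X ^ N ⊖ Y))) m n
    ≡⟨ cong₂ ℤ._-_ (g⊛[X^⊖Y] m n) (shift-cong 1 (g⊛[X^⊖Y] m) n) ⟩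
  ((shiftX N g ⊖ shiftY 1 g) ⊖ shiftY 1 (shiftX N g ⊖ shiftY 1 g)) m n
    ≡⟨ go m n ⟩
  (shiftX N b ⊖ shiftY 1 b) m n ∎
  where
  g⊛[X^⊖Y] : g ⊛ (X ^ N ⊖ Y) ≈ shiftX N g ⊖ shiftY 1 g
  g⊛[X^⊖Y] m n = trans (⊛-distribˡ-⊖ g (X ^ N) Y m n)
    (cong₂ ℤ._-_ (⊛-≈shiftX N g (X^≈shiftX N) m n) (⊛-Y g m n))

  shiftX-g : ∀ m n → shiftX N g m n ≡ shiftX N b m n ℤ.+ shiftX N (shiftY 1 g) m n
  shiftX-g m n = trans (shift-cong N (λ m → g-rec m n) m) (shift-+ N _ _ m)

  cancel₀ : ∀ a → a ℤ.+ 0ℤ ℤ.- 0ℤ ℤ.- 0ℤ ≡ a ℤ.- 0ℤ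
  cancel₀ = ℤ.solve-∀

  cancel : ∀ a c b h → a ℤ.+ c ℤ.- (b ℤ.+ h) ℤ.- (c ℤ.- h) ≡ a ℤ.- b
  cancel = ℤ.solve-∀

  go : (shiftX N g ⊖ shiftY 1 g) ⊖ shiftY 1 (shiftX N g ⊖ shiftY 1 g) ≈ shiftX N b ⊖ shiftY 1 b
  go m zero    = trans
    (cong (λ z → z ℤ.- 0ℤ ℤ.- 0ℤ) (trans (shiftX-g m zero)
      (cong (λ z → shiftX N b m zero ℤ.+ z) (shift-0 N m))))
    (cancel₀ (shiftX N b m zero))
  -- At y^(n+1), `shiftX N (shiftY 1 g)` computes to `shiftX N g` at y^n, which cancels against the
  -- last bracket.
  go m (suc n) = trans
    (cong₂ (λ z w → z ℤ.- w ℤ.- (shiftX N g m n ℤ.- shiftY 1 g m n)) (shiftX-g m (suc n)) (g-rec m n))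
    (cancel (shiftX N b m (suc n)) (shiftX N g m n) (b m n) (shiftY 1 g m n))

-- Recursions for the generating functions and the two identities

B : ℕ → Series
B r k e = + β r k e

F-rec : ∀ r m n → F r m n ≡ B r m n ℤ.+ shiftY 1 (F r) m n
F-rec r m zero    = trans (cong +_ (α-zero r m)) (sym (ℤ.+-identityʳ _))
F-rec r m (suc n) = cong +_ (α-suc r m n)

-- The shift by r + 1 vanishes at m < r + 1, matching `β-<`, and otherwise reads the entry at m - (r
-- + 1), matching `β-+`.
B-rec : ∀ r m n → B (suc r) m n ≡ F r m n ℤ.+ shift (suc r) (λ m → B (suc r) m (suc n)) m
B-rec r m n with suc r ℕ.≤? m
... | no r≮m = begin
  + β (suc r) m n       ≡⟨ cong +_ (β-< m<1+r n) ⟩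
  F r m n               ≡⟨ ℤ.+-identityʳ _ ⟨
  F r m n ℤ.+ 0ℤ        ≡⟨ cong (λ z → F r m n ℤ.+ z) (shift-< m<1+r _) ⟨
  F r m n ℤ.+ shift (suc r) (λ m → B (suc r) m (suc n)) m ∎
  where m<1+r = ℕ.≰⇒> r≮m
... | yes r<m with k , refl ← ℕ.m≤n⇒∃[o]m+o≡n r<m = begin
  + β (suc r) m n                       ≡⟨ cong +_ (β-+ r k n) ⟩
  F r m n ℤ.+ B (suc r) k (suc n)       ≡⟨ cong (λ z → F r m n ℤ.+ z) (shift-at-+ (suc r) _ k) ⟨
  F r m n ℤ.+ shift (suc r) (λ m → B (suc r) m (suc n)) m ∎

F₀⊛[𝟙⊖Y]² : F 0 ⊛ (𝟙 ⊖ Y) ^ 2 ≈ 𝟙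
F₀⊛[𝟙⊖Y]² m n = begin
  (F 0 ⊛ ((𝟙 ⊖ Y) ⊛ ((𝟙 ⊖ Y) ⊛ 𝟙))) m n
    ≡⟨ ⊛-congˡ (F 0) (⊛-congˡ (𝟙 ⊖ Y) (⊛-identityʳ (𝟙 ⊖ Y))) m n ⟩
  (F 0 ⊛ ((𝟙 ⊖ Y) ⊛ (𝟙 ⊖ Y))) m n
    ≡⟨ ⊛-assoc-𝟙⊖Y (F 0) (𝟙 ⊖ Y) m n ⟩
  (F 0 ⊛ (𝟙 ⊖ Y) ⊖ shiftY 1 (F 0 ⊛ (𝟙 ⊖ Y))) m n
    ≡⟨ cong₂ ℤ._-_ (F₀⊛[𝟙⊖Y] m n) (shift-cong 1 (F₀⊛[𝟙⊖Y] m) n) ⟩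
  (B 0 ⊖ shiftY 1 (B 0)) m n
    ≡⟨ B₀ m n ⟩
  𝟙 m n ∎
  where
  cancel : ∀ a s → a ℤ.+ s ℤ.- s ≡ a
  cancel = ℤ.solve-∀

  F₀⊛[𝟙⊖Y] : F 0 ⊛ (𝟙 ⊖ Y) ≈ B 0
  F₀⊛[𝟙⊖Y] m n = trans (⊛-𝟙⊖Y (F 0) m n)
    (trans (cong (ℤ._- shiftY 1 (F 0) m n) (F-rec 0 m n)) (cancel (B 0 m n) (shiftY 1 (F 0) m n)))

  -- The empty tuple is an index only for k = 0, so `B 0` is the geometric series 1 / (1 - y).
  B₀ : B 0 ⊖ shiftY 1 (B 0) ≈ 𝟙
  B₀ zero    zero    = refl
  B₀ zero    (suc n) = refl
  B₀ (suc m) zero    = refl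
  B₀ (suc m) (suc n) = refl

proposition3 : (F 0 ⊛ (𝟙 ⊖ Y) ^ 2 ≈ 𝟙)
    × (∀ (r : ℕ) →
    F (suc r) ⊛ ((X ^ suc r ⊖ Y) ⊛ (𝟙 ⊖ Y))
    ≈ F r [y≔ X ^ suc r ] ⊛ X ^ suc r ⊖ F r ⊛ Y)
-- Both sides of (ii) equal (x^(r+1) - y) b with b = `B (suc r)`.
proposition3 = F₀⊛[𝟙⊖Y]² , λ r m n → trans
  (⊛-[X^⊖Y]-[𝟙⊖Y] (suc r) (F-rec (suc r)) m n)
  (shift-recursion (suc r) (B-rec r) m n)
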